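{- Let $p,q\in\mathbb{Z}$ be odd primes. Then $$\left(\frac{p}{q}\right)\left(\frac{q}{p}\right)=(-1)^{\frac{p-1}{2}\cdot\frac{q-1}{2}}.$$ Alternatively, this can be expressed as: $\left(\frac{p}{q}\right)=\left(\frac{q}{p}\right)$ if $p\equiv 1\pmod 4$ or $q\equiv 1\pmod 4$, and $\left(\frac{p}{q}\right)=-\left(\frac{q}{p}\right)$ if $p\equiv 3\pmod 4$ and $q\equiv 3\pmod 4$.
   Context: $\left(\frac{a}{p}\right)$ denotes the Legendre symbol of the integer $a$ modulo the odd prime $p$.
   Formalization: The product formula is stated for distinct odd primes p ≠ q, since for p = q its left side is 0 and its right side is ±1 (e.g. p = q = 3 gives 0 versus −1); the two clauses modulo 4 are stated for all odd primes. -}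

module Defs where

open import Data.Bool.Base using (if_then_else_)
open import Data.Fin.Base using (toℕ; fromℕ<)
open import Data.Fin.Properties using (any?; toℕ-fromℕ<)
open import Data.Integer.Base
open import Data.Integer.Divisibility.Signed
open import Data.Integer.DivMod using (a≡a%ℕn+[a/ℕn]*n; n%ℕd<d)
open import Data.Integer.Tactic.RingSolver using (solve-∀)
open import Data.Nat.Base as ℕ using (ℕ)
open import Data.Nat.Primality using (Prime; prime⇒nonZero)
open import Data.Product.Base using (_,_; ∃-syntax)
open import Relation.Binary.PropositionalEquality
  using (_≡_; refl; cong; sym; subst; module ≡-Reasoning)
open import Relation.Nullary.Decidable using (Dec; does; map′)

SquareMod : ℕ → ℤ → Set
SquareMod n a = ∃[ x ] + n ∣ x * x - a

private
  shift : ∀ r k n a → (r + k * n) * (r + k * n) - a + (- (k * (r + r + k * n))) * n ≡ r * r - a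
  shift = solve-∀

  reduce : ∀ n .{{_ : ℕ.NonZero n}} a x → + n ∣ x * x - a →
           + n ∣ + (x %ℕ n) * + (x %ℕ n) - a
  reduce n a x n∣ = subst (+ n ∣_) eq (∣m∣n⇒∣m+n n∣ (divides c refl))
    where
    r = + (x %ℕ n)
    k = x /ℕ n
    c = - (k * (r + r + k * + n))
    open ≡-Reasoning
    eq : x * x - a + c * + n ≡ r * r - a
    eq = begin
      x * x - a + c * + n
        ≡⟨ cong (λ y → y * y - a + c * + n) (a≡a%ℕn+[a/ℕn]*n x n) ⟩
      (r + k * + n) * (r + k * + n) - a + c * + n
        ≡⟨ shift r k (+ n) a ⟩
      r * r - a ∎

squareMod? : ∀ n .{{_ : ℕ.NonZero n}} a → Dec (SquareMod n a)
squareMod? n a = map′ (λ (i , n∣) → + toℕ i , n∣) from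
  (any? (λ i → + n ∣? + toℕ i * + toℕ i - a))
  where
  from : SquareMod n a → ∃[ i ] + n ∣ + toℕ {n} i * + toℕ i - a
  from (x , n∣) = fromℕ< (n%ℕd<d x n) ,
    subst (λ j → + n ∣ + j * + j - a) (sym (toℕ-fromℕ< (n%ℕd<d x n))) (reduce n a x n∣)

-- Multiples of p also satisfy SquareMod p, so divisibility is tested first.
legendre : ℤ → (p : ℕ) → .{{Prime p}} → ℤ
legendre a p {{p-prime}} =
  if does (+ p ∣? a) then 0ℤ
  else if does (squareMod? p {{prime⇒nonZero p-prime}} a) then 1ℤ
  else -1ℤ

{-# OPTIONS --safe #-}
module Submission where

-- Eisenstein's proof. Write p = 2P + 1 and q = 2Q + 1. Euler's criterion (q/p) ≡ q^P mod p comes from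
-- pairing x with a/x in (p - 1)!, together with Wilson's and Fermat's theorems. Multiplication by q
-- permutes the residues (-1)^a a, 1 ≤ a ≤ P, up to the signs (-1)^⌊qa/p⌋, so q^P is congruent to the
-- product of these signs. Since ⌊qa/p⌋ counts the lattice points (a , b) with 1 ≤ b ≤ Q below the line
-- p y = q x, that product is a product of -1 over the points of the P × Q rectangle below the line.
-- Exchanging p and q gives the points above it, and no lattice point of the rectangle lies on it.

open import Defs
open import Data.Integer.Base using (ℤ; +_; -_; _*_; _^_; -1ℤ)
open import Data.Nat.Base as ℕ using (ℕ; _∸_; _/_; _%_)
open import Data.Nat.Divisibility using (_∣_)
open import Data.Nat.Primality using (Prime)
open import Data.Product.Base using (_×_)
open import Data.Sum.Base using (_⊎_)
open import Relation.Nullary using (¬_)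
open import Relation.Binary.PropositionalEquality using (_≡_; _≢_)

open import Algebra.Bundles using (CommutativeMonoid)
import Algebra.Properties.CommutativeMonoid.Sum as Sum
open import Data.Bool.Base using (Bool; true; false; if_then_else_)
open import Data.Bool.Properties using (if-eta)
open import Data.Fin.Base as Fin using (Fin; zero; suc; toℕ; fromℕ<; punchOut)
open import Data.Fin.Permutation using (Permutation′; permutation)
import Data.Fin.Properties as Fin
import Data.Integer.Base as ℤ
open import Data.Integer.Base using (0ℤ; 1ℤ; _+_; _-_; ∣_∣)
import Data.Integer.Divisibility.Signed as Signed
open import Data.Integer.DivMod using (_%ℕ_; _/ℕ_; a≡a%ℕn+[a/ℕn]*n; n%ℕd<d)
import Data.Integer.Properties as ℤ
open import Data.Integer.Tactic.RingSolver using (solve-∀)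
import Data.Nat.DivMod as ℕ
import Data.Nat.Divisibility as ℕ
import Data.Nat.Properties as ℕ
import Data.Nat.Tactic.RingSolver as ℕSolver
open import Data.Nat.Primality using (euclidsLemma; prime⇒irreducible; prime⇒nonZero; ¬prime[1])
open import Data.Product.Base using (_,_; ∃-syntax; proj₁; proj₂)
open import Data.Sum.Base using (inj₁; inj₂; [_,_]′; map₁)
open import Function.Base using (_∘_; flip)
open import Function.Bundles using (mk⇔)
open import Function.Definitions using (Injective)
open import Relation.Binary.Definitions using (tri<; tri≈; tri>)
open import Relation.Binary.PropositionalEquality
  using (refl; sym; trans; cong; cong₂; subst; module ≡-Reasoning)
import Relation.Binary.Reasoning.Setoid as SetoidReasoning
open import Relation.Binary.Structures using (IsEquivalence)
open import Relation.Nullary.Decidable using (Dec; does; yes; no; map′; dec-true; dec-false; does-⇔)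
open import Relation.Nullary.Negation using (contradiction)

private variable
  m n : ℕ

-- Injective self-maps of finite sets, and products over the pairs of an involution.

-- The witnesses found by search are abstract: unfolding them during conversion exhausts memory.
abstract
  injective⇒surjective : (f : Fin n → Fin n) → Injective _≡_ _≡_ f → ∀ y → ∃[ x ] f x ≡ y
  injective⇒surjective {ℕ.suc n} f inj y with Fin.any? (λ x → f x Fin.≟ y)
  ... | yes hit = hit
  ... | no miss = contradiction (Fin.injective⇒≤ avoid-inj) ℕ.1+n≰n
    where
    y≢f : ∀ x → y ≢ f x
    y≢f x y≡fx = miss (x , sym y≡fx)
    -- If `f` misses `y`, deleting `y` from the codomain leaves an injection into a smaller set.
    avoid : Fin (ℕ.suc n) → Fin n
    avoid x = punchOut (y≢f x)
    avoid-inj : Injective _≡_ _≡_ avoid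
    avoid-inj {x} {x′} eq = inj (Fin.punchOut-injective (y≢f x) (y≢f x′) eq)

injective⇒permutation : (f : Fin n → Fin n) → Injective _≡_ _≡_ f → Permutation′ n
injective⇒permutation f inj =
  permutation f (proj₁ ∘ surj) (proj₂ ∘ surj) (λ x → inj (proj₂ (surj (f x))))
  where surj = injective⇒surjective f inj

module Pairing {c ℓ} (M : CommutativeMonoid c ℓ) where
  open CommutativeMonoid M renaming (refl to ≈-refl; sym to ≈-sym; trans to ≈-trans)
  open Sum M
  open SetoidReasoning setoid

  -- The factors at the larger member of each pair are moved by σ to the smaller one.
  sum-pairing : (σ : Fin n → Fin n) → (∀ i → σ (σ i) ≡ i) → (∀ i → σ i ≢ i) →
    (f h : Fin n → Carrier) → (∀ i → f i ∙ f (σ i) ≈ h i) →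
    sum f ≈ sum (λ i → if does (i Fin.<? σ i) then h i else ε)
  sum-pairing σ invol fixfree f h fσf≈h = begin
    sum f
      ≈⟨ sum-cong-≋ split ⟩
    sum (λ i → lower i ∙ upper i)
      ≈⟨ ∑-distrib-+ lower upper ⟩
    sum lower ∙ sum upper
      ≈⟨ ∙-congˡ (sum-permute upper (permutation σ σ invol invol)) ⟩
    sum lower ∙ sum (upper ∘ σ)
      ≈⟨ ∑-distrib-+ lower (upper ∘ σ) ⟨
    sum (λ i → lower i ∙ upper (σ i))
      ≈⟨ sum-cong-≋ merge ⟩
    sum (λ i → if does (i Fin.<? σ i) then h i else ε) ∎
    where
    lower upper : Fin _ → Carrier
    lower i = if does (i Fin.<? σ i) then f i else ε
    upper i = if does (σ i Fin.<? i) then f i else ε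
    split : ∀ i → f i ≈ lower i ∙ upper i
    split i with Fin.<-cmp i (σ i)
    ... | tri< lt _ ngt rewrite dec-true (i Fin.<? σ i) lt | dec-false (σ i Fin.<? i) ngt =
      ≈-sym (identityʳ _)
    ... | tri≈ _ eq _ = contradiction (sym eq) (fixfree i)
    ... | tri> nlt _ gt rewrite dec-false (i Fin.<? σ i) nlt | dec-true (σ i Fin.<? i) gt =
      ≈-sym (identityˡ _)
    merge : ∀ i → lower i ∙ upper (σ i) ≈ (if does (i Fin.<? σ i) then h i else ε)
    merge i rewrite invol i with does (i Fin.<? σ i)
    ... | true = fσf≈h i
    ... | false = identityˡ ε

-- Finite sums, finite products and signs.

module Σ = Sum ℕ.+-0-commutativeMonoid
module Π = Sum ℤ.*-1-commutativeMonoid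

∏ : (Fin n → ℤ) → ℤ
∏ = Π.sum

∏-const : ∀ n x → ∏ {n} (λ _ → x) ≡ x ^ n
∏-const ℕ.zero x = refl
∏-const (ℕ.suc n) x = cong (x *_) (∏-const n x)

∏-if : (b : Fin n → Bool) (x : ℤ) →
       ∏ (λ i → if b i then x else 1ℤ) ≡ x ^ Σ.sum (λ i → if b i then 1 else 0)
∏-if {ℕ.zero} b x = refl
∏-if {ℕ.suc n} b x with b zero
... | true = cong (x *_) (∏-if (b ∘ suc) x)
... | false = trans (ℤ.*-identityˡ _) (∏-if (b ∘ suc) x)

∏-initial : ∀ {k n} → k ℕ.≤ n → (x : ℤ) →
            ∏ {n} (λ j → if does (toℕ j ℕ.<? k) then x else 1ℤ) ≡ x ^ k
∏-initial {n = n} ℕ.z≤n x = trans (∏-const n 1ℤ) (ℤ.^-zeroˡ n)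
∏-initial (ℕ.s≤s k≤n) x = cong (x *_) (∏-initial k≤n x)

sum-ones : ∀ n → Σ.sum {n} (λ _ → 1) ≡ n
sum-ones ℕ.zero = refl
sum-ones (ℕ.suc n) = cong ℕ.suc (sum-ones n)

double-injective : m ℕ.+ m ≡ n ℕ.+ n → m ≡ n
double-injective {m} {n} eq = ℕ.*-cancelʳ-≡ m n 2 (trans (twice m) (trans eq (sym (twice n))))
  where
  twice : ∀ k → k ℕ.* 2 ≡ k ℕ.+ k
  twice = ℕSolver.solve-∀

-- With all weights equal to 1, each pair contributes 2 to the total n + n, and it is recorded once,
-- at its smaller member.
count-lower : (σ : Fin (n ℕ.+ n) → Fin (n ℕ.+ n)) → (∀ i → σ (σ i) ≡ i) → (∀ i → σ i ≢ i) →
              Σ.sum (λ i → if does (i Fin.<? σ i) then 1 else 0) ≡ n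
count-lower {n} σ invol fixfree = double-injective (begin
  Σ.sum b ℕ.+ Σ.sum b
    ≡⟨ Σ.∑-distrib-+ b b ⟨
  Σ.sum (λ i → b i ℕ.+ b i)
    ≡⟨ Σ.sum-cong-≗ (λ i → double (does (i Fin.<? σ i))) ⟩
  Σ.sum (λ i → if does (i Fin.<? σ i) then 2 else 0)
    ≡⟨ Pairing.sum-pairing ℕ.+-0-commutativeMonoid σ invol fixfree (λ _ → 1) (λ _ → 2) (λ _ → refl) ⟨
  Σ.sum {n ℕ.+ n} (λ _ → 1)
    ≡⟨ sum-ones (n ℕ.+ n) ⟩
  n ℕ.+ n ∎)
  where
  open ≡-Reasoning
  b : Fin (n ℕ.+ n) → ℕ
  b i = if does (i Fin.<? σ i) then 1 else 0
  double : ∀ t → (if t then 1 else 0) ℕ.+ (if t then 1 else 0) ≡ (if t then 2 else 0)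
  double true = refl
  double false = refl

square-sign : ∀ n → -1ℤ ^ n * -1ℤ ^ n ≡ 1ℤ
square-sign ℕ.zero = refl
square-sign (ℕ.suc n) = trans (neg² (-1ℤ ^ n)) (square-sign n)
  where
  neg² : ∀ x → (-1ℤ * x) * (-1ℤ * x) ≡ x * x
  neg² = solve-∀

-1^even : ∀ n → -1ℤ ^ (n ℕ.+ n) ≡ 1ℤ
-1^even n = trans (ℤ.^-distribˡ-+-* -1ℤ n n) (square-sign n)

-1^odd : ∀ n → -1ℤ ^ ℕ.suc (n ℕ.+ n) ≡ -1ℤ
-1^odd n = cong (-1ℤ *_) (-1^even n)

-- As p and q are odd, this transfers signs between the exponents a and q a, and between k and p k.
-1^odd* : ∀ n m → -1ℤ ^ (ℕ.suc (n ℕ.+ n) ℕ.* m) ≡ -1ℤ ^ m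
-1^odd* n m = trans (sym (ℤ.^-*-assoc -1ℤ (ℕ.suc (n ℕ.+ n)) m)) (cong (_^ m) (-1^odd n))

IsSign : ℤ → Set
IsSign s = s ≡ 1ℤ ⊎ s ≡ -1ℤ

isSign-* : ∀ {s t} → IsSign s → IsSign t → IsSign (s * t)
isSign-* (inj₁ refl) (inj₁ refl) = inj₁ refl
isSign-* (inj₁ refl) (inj₂ refl) = inj₂ refl
isSign-* (inj₂ refl) (inj₁ refl) = inj₂ refl
isSign-* (inj₂ refl) (inj₂ refl) = inj₁ refl

isSign-∏ : (f : Fin n → ℤ) → (∀ i → IsSign (f i)) → IsSign (∏ f)
isSign-∏ {ℕ.zero} f sgn = inj₁ refl
isSign-∏ {ℕ.suc n} f sgn = isSign-* (sgn zero) (isSign-∏ (f ∘ suc) (sgn ∘ suc))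

-- Congruence modulo n.

module Congruence (n : ℕ) where
  infix 4 _≈_
  -- A record keeps `a` and `b` recoverable from the type of a congruence, which divisibility of
  -- `a - b` alone would not allow.
  record _≈_ (a b : ℤ) : Set where
    constructor congruent
    field difference : + n Signed.∣ a - b
  open _≈_ public

  ≈-refl : ∀ {a} → a ≈ a
  ≈-refl {a} = congruent (Signed.divides 0ℤ (ℤ.+-inverseʳ a))

  ≈-sym : ∀ {a b} → a ≈ b → b ≈ a
  ≈-sym {a} {b} (congruent d) = congruent (subst (+ n Signed.∣_) (eq a b) (Signed.∣m⇒∣-m d))
    where
    eq : ∀ a b → - (a - b) ≡ b - a
    eq = solve-∀

  ≈-trans : ∀ {a b c} → a ≈ b → b ≈ c → a ≈ c
  ≈-trans {a} {b} {c} (congruent d) (congruent e) =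
    congruent (subst (+ n Signed.∣_) (eq a b c) (Signed.∣m∣n⇒∣m+n d e))
    where
    eq : ∀ a b c → (a - b) + (b - c) ≡ a - c
    eq = solve-∀

  ≈-isEquivalence : IsEquivalence _≈_
  ≈-isEquivalence = record { refl = ≈-refl ; sym = ≈-sym ; trans = ≈-trans }

  ≈-reflexive : ∀ {a b} → a ≡ b → a ≈ b
  ≈-reflexive refl = ≈-refl

  *-cong : ∀ {a b c d} → a ≈ b → c ≈ d → a * c ≈ b * d
  *-cong {a} {b} {c} {d} (congruent x) (congruent y) =
    congruent (subst (+ n Signed.∣_) (eq a b c d)
      (Signed.∣m∣n⇒∣m+n (Signed.∣n⇒∣m*n c x) (Signed.∣n⇒∣m*n b y)))
    where
    eq : ∀ a b c d → c * (a - b) + b * (c - d) ≡ a * c - b * d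
    eq = solve-∀

  *-commutativeMonoid : CommutativeMonoid _ _
  *-commutativeMonoid = record
    { Carrier = ℤ
    ; _≈_ = _≈_
    ; _∙_ = _*_
    ; ε = 1ℤ
    ; isCommutativeMonoid = record
      { isMonoid = record
        { isSemigroup = record
          { isMagma = record { isEquivalence = ≈-isEquivalence ; ∙-cong = *-cong }
          ; assoc = λ a b c → ≈-reflexive (ℤ.*-assoc a b c)
          }
        ; identity = (λ a → ≈-reflexive (ℤ.*-identityˡ a)) , (λ a → ≈-reflexive (ℤ.*-identityʳ a))
        }
      ; comm = λ a b → ≈-reflexive (ℤ.*-comm a b)
      }
    }

  open CommutativeMonoid *-commutativeMonoid public using (setoid)
    renaming (∙-congˡ to *-congˡ; ∙-congʳ to *-congʳ)
  open Pairing *-commutativeMonoid public using () renaming (sum-pairing to ∏-pairing)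

  ∏-cong : ∀ {k} {f g : Fin k → ℤ} → (∀ i → f i ≈ g i) → ∏ f ≈ ∏ g
  ∏-cong = Sum.sum-cong-≋ *-commutativeMonoid

  ^-cong : ∀ k {a b} → a ≈ b → a ^ k ≈ b ^ k
  ^-cong ℕ.zero _ = ≈-refl
  ^-cong (ℕ.suc k) a≈b = *-cong a≈b (^-cong k a≈b)

  ≈0⇒∣ : ∀ {a} → a ≈ 0ℤ → + n Signed.∣ a
  ≈0⇒∣ {a} (congruent d) = subst (+ n Signed.∣_) (ℤ.+-identityʳ a) d

  ∣⇒≈0 : ∀ {a} → + n Signed.∣ a → a ≈ 0ℤ
  ∣⇒≈0 {a} d = congruent (subst (+ n Signed.∣_) (sym (ℤ.+-identityʳ a)) d)

  abstract
    _≈?_ : ∀ a b → Dec (a ≈ b)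
    a ≈? b = map′ congruent difference (+ n Signed.∣? a - b)

  -- A positive multiple of n is at least n.
  small-≈0 : ∀ {k} → + k ≈ 0ℤ → k ℕ.< n → k ≡ 0
  small-≈0 {ℕ.zero} _ _ = refl
  small-≈0 {ℕ.suc k} d k<n =
    contradiction (ℕ.∣⇒≤ (Signed.∣⇒∣ᵤ (≈0⇒∣ d))) (ℕ.<⇒≱ k<n)

  -- Subtracting the smaller number from the larger gives a multiple of n below n, hence 0.
  small-≈ : ∀ {a b} → + a ≈ + b → a ℕ.< n → b ℕ.< n → a ≡ b
  small-≈ {a} {b} a≈b a<n b<n with ℕ.≤-total a b
  ... | inj₁ a≤b = ℕ.≤-antisym a≤b (ℕ.m∸n≡0⇒m≤n (small-≈0 (∣⇒≈0 (subst (+ n Signed.∣_)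
        (trans (ℤ.[+m]-[+n]≡m⊖n b a) (ℤ.⊖-≥ a≤b)) (difference (≈-sym a≈b))))
        (ℕ.≤-<-trans (ℕ.m∸n≤m b a) b<n)))
  ... | inj₂ b≤a = ℕ.≤-antisym (ℕ.m∸n≡0⇒m≤n (small-≈0 (∣⇒≈0 (subst (+ n Signed.∣_)
        (trans (ℤ.[+m]-[+n]≡m⊖n a b) (ℤ.⊖-≥ b≤a)) (difference a≈b)))
        (ℕ.≤-<-trans (ℕ.m∸n≤m a b) a<n))) b≤a

  multiple+ : ∀ {x r} k → x ≡ r + k * + n → x ≈ r
  multiple+ {x} {r} k refl = congruent (Signed.divides k (eq r (k * + n)))
    where
    eq : ∀ r y → r + y - r ≡ y
    eq = solve-∀

-- Values of the Legendre symbol.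

module _ (a : ℤ) (p : ℕ) (p-prime : Prime p) where
  private
    -- The body of `legendre` with its two tests as Booleans, so that each test can be replaced by
    -- its outcome through `cong`.
    value : Bool → Bool → ℤ
    value divides square = if divides then 0ℤ else if square then 1ℤ else -1ℤ

  legendre-multiple : + p Signed.∣ a → legendre a p {{p-prime}} ≡ 0ℤ
  legendre-multiple p∣a =
    cong (λ d → value d (does (squareMod? p {{prime⇒nonZero p-prime}} a)))
      (dec-true (+ p Signed.∣? a) p∣a)

  legendre-residue : ¬ + p Signed.∣ a → SquareMod p a → legendre a p {{p-prime}} ≡ 1ℤ
  legendre-residue p∤a res = cong₂ value (dec-false (+ p Signed.∣? a) p∤a)
    (dec-true (squareMod? p {{prime⇒nonZero p-prime}} a) res)

  legendre-nonresidue : ¬ + p Signed.∣ a → ¬ SquareMod p a → legendre a p {{p-prime}} ≡ -1ℤ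
  legendre-nonresidue p∤a nonres = cong₂ value (dec-false (+ p Signed.∣? a) p∤a)
    (dec-false (squareMod? p {{prime⇒nonZero p-prime}} a) nonres)

  legendre-sign : ¬ + p Signed.∣ a → IsSign (legendre a p {{p-prime}})
  legendre-sign p∤a = by-cases (squareMod? p {{prime⇒nonZero p-prime}} a)
    where
    by-cases : Dec (SquareMod p a) → IsSign (legendre a p {{p-prime}})
    by-cases (yes res) = inj₁ (legendre-residue p∤a res)
    by-cases (no nonres) = inj₂ (legendre-nonresidue p∤a nonres)

-- Units and signs modulo an odd prime.

-- Fin (p ∸ 1) indexes the nonzero classes mod p.
val : Fin n → ℤ
val i = + ℕ.suc (toℕ i)

-- Here p = 2P + 1 with P = P′ + 1, so that P is positive by construction and the class of 1 has the
-- index `zero`.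
module OddPrime (P′ : ℕ) (p-prime : Prime (ℕ.suc (ℕ.suc P′ ℕ.+ ℕ.suc P′))) where
  P p : ℕ
  P = ℕ.suc P′
  p = ℕ.suc (P ℕ.+ P)

  open Congruence p public

  Unit : ℤ → Set
  Unit a = ¬ a ≈ 0ℤ

  euclid : ∀ a b → a * b ≈ 0ℤ → a ≈ 0ℤ ⊎ b ≈ 0ℤ
  euclid a b ab≈0
    with euclidsLemma ∣ a ∣ ∣ b ∣ p-prime
           (subst (p ∣_) (ℤ.abs-* a b) (Signed.∣⇒∣ᵤ (≈0⇒∣ ab≈0)))
  ... | inj₁ p∣a = inj₁ (∣⇒≈0 (Signed.∣ᵤ⇒∣ p∣a))
  ... | inj₂ p∣b = inj₂ (∣⇒≈0 (Signed.∣ᵤ⇒∣ p∣b))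

  unit-* : ∀ {a b} → Unit a → Unit b → Unit (a * b)
  unit-* {a} {b} ua ub ab≈0 = [ ua , ub ]′ (euclid a b ab≈0)

  unit-1 : Unit 1ℤ
  unit-1 1≈0 with () ← small-≈0 1≈0 (ℕ.s≤s (ℕ.s≤s ℕ.z≤n))

  unit--1 : Unit -1ℤ
  unit--1 -1≈0 = unit-1 (*-congˡ { -1ℤ} -1≈0)

  unit-∏ : ∀ {n} (f : Fin n → ℤ) → (∀ i → Unit (f i)) → Unit (∏ f)
  unit-∏ {ℕ.zero} f uf = unit-1
  unit-∏ {ℕ.suc n} f uf = unit-* (uf zero) (unit-∏ (f ∘ suc) (uf ∘ suc))

  *-cancelˡ : ∀ {c a b} → Unit c → c * a ≈ c * b → a ≈ b
  *-cancelˡ {c} {a} {b} uc (congruent d) =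
    [ flip contradiction uc , congruent ∘ ≈0⇒∣ ]′
      (euclid c (a - b) (∣⇒≈0 (subst (+ p Signed.∣_) (eq c a b) d)))
    where
    eq : ∀ c a b → c * a - c * b ≡ c * (a - b)
    eq = solve-∀

  *-cancelʳ : ∀ {c a b} → Unit c → a * c ≈ b * c → a ≈ b
  *-cancelʳ {c} {a} {b} uc eq = *-cancelˡ uc
    (≈-trans (≈-reflexive (ℤ.*-comm c a)) (≈-trans eq (≈-reflexive (ℤ.*-comm b c))))

  squares-≈ : ∀ a b → a * a ≈ b * b → a ≈ b ⊎ a + b ≈ 0ℤ
  squares-≈ a b (congruent d) =
    map₁ (congruent ∘ ≈0⇒∣) (euclid (a - b) (a + b) (∣⇒≈0 (subst (+ p Signed.∣_) (eq a b) d)))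
    where
    eq : ∀ a b → a * a - b * b ≡ (a - b) * (a + b)
    eq = solve-∀

  +1≈0⇒≈-1 : ∀ {a} → a + 1ℤ ≈ 0ℤ → a ≈ -1ℤ
  +1≈0⇒≈-1 a+1≈0 = congruent (≈0⇒∣ a+1≈0)

  -- The difference is 2, and p is at least 3.
  1≉-1 : ¬ 1ℤ ≈ -1ℤ
  1≉-1 (congruent d) with () ← small-≈0 {2} (∣⇒≈0 d)
    (ℕ.s≤s (ℕ.s≤s (subst (1 ℕ.≤_) (sym (ℕ.+-suc P′ P′)) (ℕ.s≤s ℕ.z≤n))))

  -- This turns the congruence between the Legendre symbol and the lattice point product into an
  -- equality.
  sign-≈ : ∀ {s t} → IsSign s → IsSign t → s ≈ t → s ≡ t
  sign-≈ (inj₁ refl) (inj₁ refl) _ = refl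
  sign-≈ (inj₁ refl) (inj₂ refl) s≈t = contradiction s≈t 1≉-1
  sign-≈ (inj₂ refl) (inj₁ refl) s≈t = contradiction (≈-sym s≈t) 1≉-1
  sign-≈ (inj₂ refl) (inj₂ refl) _ = refl

  val-< : ∀ {n} → n ℕ.< p → (i : Fin n) → ℕ.suc (toℕ i) ℕ.< p
  val-< n<p i = ℕ.≤-<-trans (Fin.toℕ<n i) n<p

  val-unit : ∀ {n} → n ℕ.< p → (i : Fin n) → Unit (val i)
  val-unit n<p i v≈0 with () ← small-≈0 v≈0 (val-< n<p i)

  val-injective : ∀ {n} → n ℕ.< p → {i j : Fin n} → val i ≈ val j → i ≡ j
  val-injective n<p {i} {j} eq =
    Fin.toℕ-injective (ℕ.suc-injective (small-≈ eq (val-< n<p i) (val-< n<p j)))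

  half<p : P ℕ.< p
  half<p = ℕ.s≤s (ℕ.m≤m+n P P)

  full<p : P ℕ.+ P ℕ.< p
  full<p = ℕ.n<1+n (P ℕ.+ P)

  abstract
    residue : ∀ a → Unit a → ∃[ i ] a ≈ val {P ℕ.+ P} i
    residue a ua = go (a %ℕ p) (n%ℕd<d a p) (multiple+ (a /ℕ p) (a≡a%ℕn+[a/ℕn]*n a p))
      where
      go : ∀ r → r ℕ.< p → a ≈ + r → ∃[ i ] a ≈ val {P ℕ.+ P} i
      go ℕ.zero _ a≈0 = contradiction a≈0 ua
      go (ℕ.suc r) r<p a≈r = fromℕ< (ℕ.s<s⁻¹ r<p) ,
        ≈-trans a≈r (≈-reflexive (cong (λ k → + ℕ.suc k) (sym (Fin.toℕ-fromℕ< (ℕ.s<s⁻¹ r<p)))))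

  -- Multiplication by a unit as a permutation, and Fermat's theorem.

  -- An injective `α` permutes the factors, so multiplying all the congruences gives a^n ∏ f ≈ ∏ c ∏
  -- f, and the unit ∏ f cancels. Constant `c` = 1 yields Fermat's theorem; signs `c` yield Gauss's
  -- lemma in Eisenstein's form.
  gauss : ∀ {n} (f c : Fin n → ℤ) → (∀ i → Unit (f i)) →
    (α : Fin n → Fin n) → Injective _≡_ _≡_ α →
    ∀ a → (∀ i → a * f i ≈ c i * f (α i)) → a ^ n ≈ ∏ c
  gauss {n} f c uf α α-inj a eq = *-cancelʳ (unit-∏ f uf) (begin
    a ^ n * ∏ f
      ≡⟨ cong (_* ∏ f) (∏-const n a) ⟨
    ∏ (λ (i : Fin n) → a) * ∏ f
      ≡⟨ Π.∑-distrib-+ (λ _ → a) f ⟨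
    ∏ (λ i → a * f i)
      ≈⟨ ∏-cong eq ⟩
    ∏ (λ i → c i * f (α i))
      ≡⟨ Π.∑-distrib-+ c (f ∘ α) ⟩
    ∏ c * ∏ (f ∘ α)
      ≡⟨ cong (∏ c *_) (Π.sum-permute f (injective⇒permutation α α-inj)) ⟨
    ∏ c * ∏ f ∎)
    where open SetoidReasoning setoid

  module _ (a : ℤ) (ua : Unit a) where
    private
      image : (i : Fin (P ℕ.+ P)) → ∃[ j ] a * val i ≈ val j
      image i = residue (a * val i) (unit-* ua (val-unit full<p i))

    scale : Fin (P ℕ.+ P) → Fin (P ℕ.+ P)
    scale i = proj₁ (image i)

    scale-val : ∀ i → a * val i ≈ val (scale i)
    scale-val i = proj₂ (image i)

    scale-injective : Injective _≡_ _≡_ scale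
    scale-injective {i} {j} eq = val-injective full<p (*-cancelˡ ua
      (≈-trans (scale-val i) (≈-trans (≈-reflexive (cong val eq)) (≈-sym (scale-val j)))))

    abstract
      -- Multiplication by a is injective on the finitely many nonzero classes, hence reaches the
      -- class of b.
      quotient : ∀ b → Unit b → ∃[ i ] a * val {P ℕ.+ P} i ≈ b
      quotient b ub =
        let j , b≈vj = residue b ub
            i , si≡j = injective⇒surjective scale scale-injective j
        in i , ≈-trans (scale-val i) (≈-trans (≈-reflexive (cong val si≡j)) (≈-sym b≈vj))

    fermat : a ^ (P ℕ.+ P) ≈ 1ℤ
    fermat = ≈-trans
      (gauss val (λ _ → 1ℤ) (val-unit full<p) scale scale-injective a
        (λ i → ≈-trans (scale-val i) (≈-reflexive (sym (ℤ.*-identityˡ _)))))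
      (≈-reflexive (trans (∏-const (P ℕ.+ P) 1ℤ) (ℤ.^-zeroˡ (P ℕ.+ P))))

  -- Pairings of the nonzero classes, Wilson's theorem and Euler's criterion.

  -- The partner of x is c(x) / x. Stability of `c` makes this an involution, and `nonsquare`
  -- excludes fixed points. Euler's criterion takes `c` constant; Wilson's theorem needs a `c` that
  -- varies.
  module Pairs (c : Fin (P ℕ.+ P) → ℤ) (uc : ∀ i → Unit (c i))
               (c-stable : ∀ i j → val i * val j ≈ c i → c j ≡ c i)
               (nonsquare : ∀ i → ¬ val i * val i ≈ c i) where
    private
      partners : ∀ i → ∃[ j ] val i * val j ≈ c i
      partners i = quotient (val i) (val-unit full<p i) (c i) (uc i)

    partner : Fin (P ℕ.+ P) → Fin (P ℕ.+ P)
    partner i = proj₁ (partners i)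

    partner-val : ∀ i → val i * val (partner i) ≈ c i
    partner-val i = proj₂ (partners i)

    partner-involutive : ∀ i → partner (partner i) ≡ i
    partner-involutive i = val-injective full<p (*-cancelˡ (val-unit full<p (partner i)) (begin
      val (partner i) * val (partner (partner i)) ≈⟨ partner-val (partner i) ⟩
      c (partner i)                               ≡⟨ c-stable i (partner i) (partner-val i) ⟩
      c i                                         ≈⟨ partner-val i ⟨
      val i * val (partner i)                     ≡⟨ ℤ.*-comm (val i) (val (partner i)) ⟩
      val (partner i) * val i                     ∎))
      where open SetoidReasoning setoid

    partner-fixfree : ∀ i → partner i ≢ i
    partner-fixfree i eq = nonsquare i (subst (λ j → val i * val j ≈ c i) eq (partner-val i))

    factorial : ∏ (val {P ℕ.+ P}) ≈ ∏ (λ i → if does (i Fin.<? partner i) then c i else 1ℤ)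
    factorial = ∏-pairing partner partner-involutive partner-fixfree val c partner-val

  wilson : ∏ (val {P ℕ.+ P}) ≈ -1ℤ
  wilson = ≈-trans factorial (≈-reflexive (cong₂ _*_ head-term
    (trans (Π.sum-cong-≗ tail-term) (trans (∏-const (P′ ℕ.+ P) 1ℤ) (ℤ.^-zeroˡ (P′ ℕ.+ P))))))
    where
    -- 1 and -1 are paired with each other, every other class with its inverse.
    SelfInverse : Fin (P ℕ.+ P) → Set
    SelfInverse i = val i * val i ≈ 1ℤ
    self? : ∀ i → Dec (SelfInverse i)
    self? i = (val i * val i) ≈? 1ℤ
    c : Fin (P ℕ.+ P) → ℤ
    c i = if does (self? i) then -1ℤ else 1ℤ
    c-self : ∀ i → SelfInverse i → c i ≡ -1ℤ
    c-self i s = cong (λ b → if b then -1ℤ else 1ℤ) (dec-true (self? i) s)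
    c-notself : ∀ i → ¬ SelfInverse i → c i ≡ 1ℤ
    c-notself i ¬s = cong (λ b → if b then -1ℤ else 1ℤ) (dec-false (self? i) ¬s)
    c-sign : ∀ i → IsSign (c i)
    c-sign i = by-cases (self? i)
      where
      by-cases : Dec (SelfInverse i) → IsSign (c i)
      by-cases (yes s) = inj₂ (c-self i s)
      by-cases (no ¬s) = inj₁ (c-notself i ¬s)
    unit-sign : ∀ {s} → IsSign s → Unit s
    unit-sign (inj₁ refl) = unit-1
    unit-sign (inj₂ refl) = unit--1
    sign² : ∀ {s} → IsSign s → s * s ≡ 1ℤ
    sign² (inj₁ refl) = refl
    sign² (inj₂ refl) = refl
    -- As x² y² = (x y)² = 1, one partner is self-inverse exactly when the other is.
    product-square : ∀ i j → val i * val j ≈ c i → (val i * val i) * (val j * val j) ≈ 1ℤ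
    product-square i j eq = begin
      (val i * val i) * (val j * val j) ≡⟨ swap (val i) (val j) ⟩
      (val i * val j) * (val i * val j) ≈⟨ *-cong eq eq ⟩
      c i * c i                         ≡⟨ sign² (c-sign i) ⟩
      1ℤ                                ∎
      where
      open SetoidReasoning setoid
      swap : ∀ x y → (x * x) * (y * y) ≡ (x * y) * (x * y)
      swap = solve-∀
    c-stable : ∀ i j → val i * val j ≈ c i → c j ≡ c i
    c-stable i j eq = by-cases (self? i)
      where
      open SetoidReasoning setoid
      by-cases : Dec (SelfInverse i) → c j ≡ c i
      by-cases (yes s) = trans (c-self j (begin
        val j * val j                     ≡⟨ ℤ.*-identityˡ _ ⟨
        1ℤ * (val j * val j)              ≈⟨ *-congʳ {val j * val j} s ⟨
        (val i * val i) * (val j * val j) ≈⟨ product-square i j eq ⟩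
        1ℤ                                ∎)) (sym (c-self i s))
      by-cases (no ¬s) = trans (c-notself j (λ s → ¬s (begin
        val i * val i                     ≡⟨ ℤ.*-identityʳ _ ⟨
        (val i * val i) * 1ℤ              ≈⟨ *-congˡ {val i * val i} s ⟨
        (val i * val i) * (val j * val j) ≈⟨ product-square i j eq ⟩
        1ℤ                                ∎))) (sym (c-notself i ¬s))
    -- Self-inverse classes have x² ≈ 1 but `c` = -1; for the others `c` = 1 but x² is not 1.
    nonsquare : ∀ i → ¬ val i * val i ≈ c i
    nonsquare i eq = by-cases (self? i)
      where
      by-cases : ¬ Dec (SelfInverse i)
      by-cases (yes s) = 1≉-1 (≈-trans (≈-sym s) (≈-trans eq (≈-reflexive (c-self i s))))
      by-cases (no ¬s) = ¬s (≈-trans eq (≈-reflexive (c-notself i ¬s)))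
    open Pairs c (λ i → unit-sign (c-sign i)) c-stable nonsquare
    -- The class 1 has the least index, so the pair of 1 and -1 is recorded here, with factor -1.
    head-term : (if does (Fin.zero {P′ ℕ.+ P} Fin.<? partner zero) then c zero else 1ℤ) ≡ -1ℤ
    head-term = go (partner zero) (partner-fixfree zero)
      where
      go : ∀ (j : Fin (P ℕ.+ P)) → j ≢ zero →
           (if does (Fin.zero {P′ ℕ.+ P} Fin.<? j) then c zero else 1ℤ) ≡ -1ℤ
      go zero 0≢0 = contradiction refl 0≢0
      go (suc j) _ = c-self zero ≈-refl
    -- The only other self-inverse class is -1. Its partner has index `zero`, so it is the larger
    -- member of its pair and contributes 1. All remaining classes have `c` = 1.
    tail-term : ∀ i → (if does (suc i Fin.<? partner (suc i)) then c (suc i) else 1ℤ) ≡ 1ℤ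
    tail-term i = by-cases (self? (suc i))
      where
      by-cases : Dec (SelfInverse (suc i)) →
                 (if does (suc i Fin.<? partner (suc i)) then c (suc i) else 1ℤ) ≡ 1ℤ
      by-cases (no ¬s) = trans
        (cong (λ x → if does (suc i Fin.<? partner (suc i)) then x else 1ℤ) (c-notself (suc i) ¬s))
        (if-eta (does (suc i Fin.<? partner (suc i))))
      by-cases (yes s) = [ if-1 , if--1 ]′ (squares-≈ (val (suc i)) 1ℤ s)
        where
        if-1 : val (suc i) ≈ 1ℤ → _
        if-1 v≈1 with () ← val-injective full<p {suc i} {zero} v≈1
        partner≡0 : val (suc i) + 1ℤ ≈ 0ℤ → partner (suc i) ≡ zero
        partner≡0 v+1≈0 = val-injective full<p (*-cancelˡ unit--1 (begin
          -1ℤ * y     ≈⟨ *-congʳ {y} {x} { -1ℤ} (+1≈0⇒≈-1 v+1≈0) ⟨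
          x * y       ≈⟨ partner-val (suc i) ⟩
          c (suc i)   ≡⟨ c-self (suc i) s ⟩
          -1ℤ * 1ℤ    ∎))
          where
          open SetoidReasoning setoid
          x = val (suc i)
          y = val (partner (suc i))
        if--1 : val (suc i) + 1ℤ ≈ 0ℤ →
               (if does (suc i Fin.<? partner (suc i)) then c (suc i) else 1ℤ) ≡ 1ℤ
        if--1 v+1≈0 = cong (λ b → if b then c (suc i) else 1ℤ)
          (dec-false (suc i Fin.<? partner (suc i))
            (subst (λ j → ¬ suc i Fin.< j) (sym (partner≡0 v+1≈0)) (λ ())))

  euler-residue : ∀ a → Unit a → SquareMod p a → a ^ P ≈ 1ℤ
  euler-residue a ua (x , p∣x²-a) = begin
    a ^ P         ≈⟨ ^-cong P {x * x} {a} (congruent p∣x²-a) ⟨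
    (x * x) ^ P   ≡⟨ cong (λ y → (x * y) ^ P) (ℤ.*-identityʳ x) ⟨
    (x ^ 2) ^ P   ≡⟨ ℤ.^-*-assoc x 2 P ⟩
    x ^ (2 ℕ.* P) ≡⟨ cong (λ k → x ^ (P ℕ.+ k)) (ℕ.+-identityʳ P) ⟩
    x ^ (P ℕ.+ P) ≈⟨ fermat x ux ⟩
    1ℤ            ∎
    where
    open SetoidReasoning setoid
    ux : Unit x
    ux x≈0 = ua (≈-trans (≈-sym (congruent p∣x²-a)) (*-congʳ {x} x≈0))

  -- As a is not a square, x and a / x always differ. Each of the P pairs has product a, so a^P is
  -- (p - 1)!.
  euler-nonresidue : ∀ a → Unit a → ¬ SquareMod p a → a ^ P ≈ -1ℤ
  euler-nonresidue a ua nonres = begin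
    a ^ P
      ≡⟨ cong (a ^_) (count-lower {P} partner partner-involutive partner-fixfree) ⟨
    a ^ Σ.sum (λ i → if does (i Fin.<? partner i) then 1 else 0)
      ≡⟨ ∏-if (λ i → does (i Fin.<? partner i)) a ⟨
    ∏ (λ i → if does (i Fin.<? partner i) then a else 1ℤ)
      ≈⟨ factorial ⟨
    ∏ (val {P ℕ.+ P})
      ≈⟨ wilson ⟩
    -1ℤ ∎
    where
    open SetoidReasoning setoid
    open Pairs (λ _ → a) (λ _ → ua) (λ _ _ _ → refl) (λ i sq → nonres (val i , difference sq))

  legendre-euler : ∀ a → Unit a →
    IsSign (legendre a p {{p-prime}}) × legendre a p {{p-prime}} ≈ a ^ P
  legendre-euler a ua = by-cases (squareMod? p {{prime⇒nonZero p-prime}} a)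
    where
    p∤a : ¬ + p Signed.∣ a
    p∤a p∣a = ua (∣⇒≈0 p∣a)
    by-cases : Dec (SquareMod p a) →
      IsSign (legendre a p {{p-prime}}) × legendre a p {{p-prime}} ≈ a ^ P
    by-cases (yes res) = inj₁ eq , ≈-trans (≈-reflexive eq) (≈-sym (euler-residue a ua res))
      where eq = legendre-residue a p p-prime p∤a res
    by-cases (no nonres) = inj₂ eq , ≈-trans (≈-reflexive eq) (≈-sym (euler-nonresidue a ua nonres))
      where eq = legendre-nonresidue a p p-prime p∤a nonres

-- Lattice points in a rectangle.

-- -1 if the lattice point (i + 1 , j + 1) lies below the line p y = q x, and 1 otherwise.
side : (p q i j : ℕ) → ℤ
side p q i j = if does (p ℕ.* ℕ.suc j ℕ.<? q ℕ.* ℕ.suc i) then -1ℤ else 1ℤ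

isSign-side : ∀ p q i j → IsSign (side p q i j)
isSign-side p q i j with does (p ℕ.* ℕ.suc j ℕ.<? q ℕ.* ℕ.suc i)
... | true = inj₂ refl
... | false = inj₁ refl

-- This is -1 to the number of lattice points of the rectangle below the line, the exponent in
-- Eisenstein's lemma.
rectangle : (p q P Q : ℕ) → ℤ
rectangle p q P Q = ∏ {P} (λ i → ∏ {Q} (λ j → side p q (toℕ i) (toℕ j)))

isSign-rectangle : ∀ p q P Q → IsSign (rectangle p q P Q)
isSign-rectangle p q P Q =
  isSign-∏ {P} _ (λ i → isSign-∏ {Q} _ (λ j → isSign-side p q (toℕ i) (toℕ j)))

-- Here k is the floor of x / p. The bound r < p excludes j + 1 > k, and 0 < r makes the inequality
-- strict at j + 1 = k.
below-line : ∀ p x j {k r} → x ≡ r ℕ.+ k ℕ.* p → 0 ℕ.< r → r ℕ.< p →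
             does (p ℕ.* ℕ.suc j ℕ.<? x) ≡ does (j ℕ.<? k)
below-line p x j {k} {r} eq 0<r r<p = does-⇔ (mk⇔ to from) (p ℕ.* ℕ.suc j ℕ.<? x) (j ℕ.<? k)
  where
  open ℕ.≤-Reasoning
  to : p ℕ.* ℕ.suc j ℕ.< x → j ℕ.< k
  to lt = ℕ.s<s⁻¹ (ℕ.*-cancelˡ-< p (ℕ.suc j) (ℕ.suc k) (begin-strict
    p ℕ.* ℕ.suc j   <⟨ lt ⟩
    x               ≡⟨ eq ⟩
    r ℕ.+ k ℕ.* p   <⟨ ℕ.+-monoˡ-< (k ℕ.* p) r<p ⟩
    p ℕ.+ k ℕ.* p   ≡⟨ ℕ.*-comm p (ℕ.suc k) ⟨
    p ℕ.* ℕ.suc k   ∎))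
  from : j ℕ.< k → p ℕ.* ℕ.suc j ℕ.< x
  from j<k = begin-strict
    p ℕ.* ℕ.suc j   ≤⟨ ℕ.*-monoʳ-≤ p j<k ⟩
    p ℕ.* k         ≡⟨ ℕ.*-comm p k ⟩
    k ℕ.* p         <⟨ ℕ.+-monoˡ-< (k ℕ.* p) 0<r ⟩
    r ℕ.+ k ℕ.* p   ≡⟨ eq ⟨
    x               ∎

-- The points below the line in this column are those of height 1 to k, and k ≤ Q keeps all of them
-- in the rectangle.
column : ∀ p q i {k r} Q → q ℕ.* ℕ.suc i ≡ r ℕ.+ k ℕ.* p → 0 ℕ.< r → r ℕ.< p → k ℕ.≤ Q →
         ∏ {Q} (λ j → side p q i (toℕ j)) ≡ -1ℤ ^ k
column p q i {k} Q eq 0<r r<p k≤Q = begin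
  ∏ {Q} (λ j → side p q i (toℕ j))
    ≡⟨ Π.sum-cong-≗ {Q} (λ j → cong (λ b → if b then -1ℤ else 1ℤ)
         (below-line p (q ℕ.* ℕ.suc i) (toℕ j) {k} eq 0<r r<p)) ⟩
  ∏ {Q} (λ j → if does (toℕ j ℕ.<? k) then -1ℤ else 1ℤ)
    ≡⟨ ∏-initial k≤Q -1ℤ ⟩
  -1ℤ ^ k ∎
  where open ≡-Reasoning

-- With p = 2P + 1 and q = 2Q + 1, k p ≤ q P < (Q + 1) p, the last gap being P + Q + 1.
quotient-bound : ∀ P Q k r i → ℕ.suc (Q ℕ.+ Q) ℕ.* i ≡ r ℕ.+ k ℕ.* ℕ.suc (P ℕ.+ P) →
                 i ℕ.≤ P → k ℕ.≤ Q
quotient-bound P Q k r i eq i≤P = ℕ.s≤s⁻¹ (ℕ.*-cancelʳ-< (ℕ.suc (P ℕ.+ P)) k (ℕ.suc Q) (begin-strict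
  k ℕ.* ℕ.suc (P ℕ.+ P)                       ≤⟨ ℕ.m≤n+m _ r ⟩
  r ℕ.+ k ℕ.* ℕ.suc (P ℕ.+ P)                 ≡⟨ eq ⟨
  ℕ.suc (Q ℕ.+ Q) ℕ.* i                       ≤⟨ ℕ.*-monoʳ-≤ (ℕ.suc (Q ℕ.+ Q)) i≤P ⟩
  ℕ.suc (Q ℕ.+ Q) ℕ.* P                       ≤⟨ ℕ.m≤m+n _ (P ℕ.+ Q) ⟩
  ℕ.suc (Q ℕ.+ Q) ℕ.* P ℕ.+ (P ℕ.+ Q)         <⟨ ℕ.n<1+n _ ⟩
  ℕ.suc (ℕ.suc (Q ℕ.+ Q) ℕ.* P ℕ.+ (P ℕ.+ Q)) ≡⟨ expand P Q ⟩
  ℕ.suc Q ℕ.* ℕ.suc (P ℕ.+ P)                 ∎))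
  where
  open ℕ.≤-Reasoning
  expand : ∀ P Q → ℕ.suc (ℕ.suc (Q ℕ.+ Q) ℕ.* P ℕ.+ (P ℕ.+ Q)) ≡ ℕ.suc Q ℕ.* ℕ.suc (P ℕ.+ P)
  expand = ℕSolver.solve-∀

-- With its two products exchanged, the second factor runs over the same points with the inequality
-- reversed. A point off the line passes exactly one of the two tests and so contributes one -1.
rectangle-reciprocity : ∀ p q P Q →
  (∀ (i : Fin P) (j : Fin Q) → p ℕ.* ℕ.suc (toℕ j) ≢ q ℕ.* ℕ.suc (toℕ i)) →
  rectangle p q P Q * rectangle q p Q P ≡ -1ℤ ^ (P ℕ.* Q)
rectangle-reciprocity p q P Q offdiagonal = begin
  rectangle p q P Q * rectangle q p Q P
    ≡⟨ cong (rectangle p q P Q *_) (Π.∑-comm {Q} {P} (λ j i → side q p (toℕ j) (toℕ i))) ⟩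
  rectangle p q P Q * ∏ {P} (λ i → ∏ {Q} (λ j → side q p (toℕ j) (toℕ i)))
    ≡⟨ Π.∑-distrib-+ {P} _ _ ⟨
  ∏ {P} (λ i → ∏ {Q} (λ j → side p q (toℕ i) (toℕ j)) * ∏ {Q} (λ j → side q p (toℕ j) (toℕ i)))
    ≡⟨ Π.sum-cong-≗ {P} row ⟩
  ∏ {P} (λ _ → -1ℤ ^ Q)
    ≡⟨ ∏-const P (-1ℤ ^ Q) ⟩
  (-1ℤ ^ Q) ^ P
    ≡⟨ ℤ.^-*-assoc -1ℤ Q P ⟩
  -1ℤ ^ (Q ℕ.* P)
    ≡⟨ cong (-1ℤ ^_) (ℕ.*-comm Q P) ⟩
  -1ℤ ^ (P ℕ.* Q) ∎
  where
  open ≡-Reasoning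
  opposite : ∀ (i : Fin P) (j : Fin Q) → side p q (toℕ i) (toℕ j) * side q p (toℕ j) (toℕ i) ≡ -1ℤ
  opposite i j with ℕ.<-cmp (p ℕ.* ℕ.suc (toℕ j)) (q ℕ.* ℕ.suc (toℕ i))
  ... | tri< lt _ ngt
    rewrite dec-true (p ℕ.* ℕ.suc (toℕ j) ℕ.<? q ℕ.* ℕ.suc (toℕ i)) lt
          | dec-false (q ℕ.* ℕ.suc (toℕ i) ℕ.<? p ℕ.* ℕ.suc (toℕ j)) ngt = refl
  ... | tri≈ _ eq _ = contradiction eq (offdiagonal i j)
  ... | tri> nlt _ gt
    rewrite dec-false (p ℕ.* ℕ.suc (toℕ j) ℕ.<? q ℕ.* ℕ.suc (toℕ i)) nlt
          | dec-true (q ℕ.* ℕ.suc (toℕ i) ℕ.<? p ℕ.* ℕ.suc (toℕ j)) gt = refl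
  row : ∀ i → ∏ {Q} (λ j → side p q (toℕ i) (toℕ j)) * ∏ {Q} (λ j → side q p (toℕ j) (toℕ i)) ≡ -1ℤ ^ Q
  row i = trans (sym (Π.∑-distrib-+ {Q} _ _))
            (trans (Π.sum-cong-≗ (opposite i)) (∏-const Q -1ℤ))

-- Eisenstein's lemma.

module Eisenstein (P′ : ℕ) (p-prime : Prime (ℕ.suc (ℕ.suc P′ ℕ.+ ℕ.suc P′)))
                  (Q : ℕ) (q-unit : OddPrime.Unit P′ p-prime (+ ℕ.suc (Q ℕ.+ Q))) where
  open OddPrime P′ p-prime

  q : ℕ
  q = ℕ.suc (Q ℕ.+ Q)

  -- The signs make these the residues of the even numbers up to p ∸ 1, in some order.
  f : Fin P → ℤ
  f i = -1ℤ ^ ℕ.suc (toℕ i) * val i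

  unit-sign^ : ∀ k → Unit (-1ℤ ^ k)
  unit-sign^ ℕ.zero = unit-1
  unit-sign^ (ℕ.suc k) = unit-* unit--1 (unit-sign^ k)

  f-unit : ∀ i → Unit (f i)
  f-unit i = unit-* (unit-sign^ (ℕ.suc (toℕ i))) (val-unit half<p i)

  signed-square : ∀ k x → (-1ℤ ^ k * x) * (-1ℤ ^ k * x) ≡ x * x
  signed-square k x = begin
    (-1ℤ ^ k * x) * (-1ℤ ^ k * x) ≡⟨ swap (-1ℤ ^ k) x ⟩
    (-1ℤ ^ k * -1ℤ ^ k) * (x * x) ≡⟨ cong (_* (x * x)) (square-sign k) ⟩
    1ℤ * (x * x)                  ≡⟨ ℤ.*-identityˡ (x * x) ⟩
    x * x                         ∎
    where
    open ≡-Reasoning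
    swap : ∀ s x → (s * x) * (s * x) ≡ (s * s) * (x * x)
    swap = solve-∀

  f² : ∀ i → f i * f i ≡ val i * val i
  f² i = signed-square (ℕ.suc (toℕ i)) (val i)

  -- Equal squares leave a ≈ b or a + b ≈ 0, and 0 < a + b ≤ 2P < p rules out the second.
  val²-injective : ∀ {i j : Fin P} → val i * val i ≈ val j * val j → i ≡ j
  val²-injective {i} {j} eq =
    [ val-injective half<p , flip contradiction sum≉0 ]′ (squares-≈ (val i) (val j) eq)
    where
    sum≉0 : ¬ val i + val j ≈ 0ℤ
    sum≉0 s≈0 with () ← small-≈0 {ℕ.suc (toℕ i) ℕ.+ ℕ.suc (toℕ j)} s≈0
      (ℕ.s≤s (ℕ.+-mono-≤ (Fin.toℕ<n i) (Fin.toℕ<n j)))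

  quot : Fin P → ℕ
  quot i = q ℕ.* ℕ.suc (toℕ i) / p

  rem : Fin P → ℕ
  rem i = q ℕ.* ℕ.suc (toℕ i) % p

  division : ∀ i → q ℕ.* ℕ.suc (toℕ i) ≡ rem i ℕ.+ quot i ℕ.* p
  division i = ℕ.m≡m%n+[m/n]*n (q ℕ.* ℕ.suc (toℕ i)) p

  -- Remainder 0 would make the product of the units q and i + 1 vanish modulo p.
  rem>0 : ∀ i → 0 ℕ.< rem i
  rem>0 i = ℕ.n≢0⇒n>0 (λ rem≡0 → unit-* q-unit (val-unit half<p i)
    (multiple+ (+ quot i) (begin
      + q * val i                 ≡⟨ ℤ.pos-* q (ℕ.suc (toℕ i)) ⟨
      + (q ℕ.* ℕ.suc (toℕ i))     ≡⟨ cong +_ (division i) ⟩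
      + (rem i ℕ.+ quot i ℕ.* p)  ≡⟨ cong (λ r → + (r ℕ.+ quot i ℕ.* p)) rem≡0 ⟩
      + (quot i ℕ.* p)            ≡⟨ ℤ.pos-* (quot i) p ⟩
      + quot i * + p              ≡⟨ ℤ.+-identityˡ _ ⟨
      0ℤ + + quot i * + p         ∎)))
    where open ≡-Reasoning

  -- Put a = i + 1. The target index stands for b = r if r ≤ P and for b = p - r otherwise, so that
  -- q a ≈ b or q a ≈ -b. As p and q are odd, comparing parities gives (-1)^a = (-1)^k (-1)^b in the
  -- first case; in the second an extra -1 appears and cancels that of -b.
  image : ∀ i {k} r → q ℕ.* ℕ.suc (toℕ i) ≡ r ℕ.+ k ℕ.* p → 0 ℕ.< r → r ℕ.< p →
          ∃[ j ] + q * f i ≈ -1ℤ ^ k * f j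
  image i {k} (ℕ.suc r) eq _ r<p with r ℕ.<? P
  ... | yes r<P = fromℕ< r<P , (begin
    + q * (-1ℤ ^ a * + a)            ≡⟨ assoc (+ q) (-1ℤ ^ a) (+ a) ⟩
    -1ℤ ^ a * (+ q * + a)            ≈⟨ *-congˡ { -1ℤ ^ a} (multiple+ (+ k) qa) ⟩
    -1ℤ ^ a * + ℕ.suc r              ≡⟨ cong (_* + ℕ.suc r) sgn ⟩
    -1ℤ ^ k * -1ℤ ^ ℕ.suc r * + ℕ.suc r
      ≡⟨ ℤ.*-assoc (-1ℤ ^ k) (-1ℤ ^ ℕ.suc r) (+ ℕ.suc r) ⟩
    -1ℤ ^ k * (-1ℤ ^ ℕ.suc r * + ℕ.suc r)
      ≡⟨ cong (λ t → -1ℤ ^ k * (-1ℤ ^ ℕ.suc t * + ℕ.suc t)) (Fin.toℕ-fromℕ< r<P) ⟨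
    -1ℤ ^ k * f (fromℕ< r<P)         ∎)
    where
    open SetoidReasoning setoid
    a = ℕ.suc (toℕ i)
    assoc : ∀ x y z → x * (y * z) ≡ y * (x * z)
    assoc = solve-∀
    qa : + q * + a ≡ + ℕ.suc r + + k * + p
    qa = trans (sym (ℤ.pos-* q a)) (trans (cong +_ eq)
           (trans (ℤ.pos-+ (ℕ.suc r) (k ℕ.* p)) (cong (λ t → + ℕ.suc r + t) (ℤ.pos-* k p))))
    -- This is `eq` read modulo 2, with p and q odd.
    sgn : -1ℤ ^ a ≡ -1ℤ ^ k * -1ℤ ^ ℕ.suc r
    sgn = trans (sym (-1^odd* Q a)) (trans (cong (-1ℤ ^_) eq)
           (trans (ℤ.^-distribˡ-+-* -1ℤ (ℕ.suc r) (k ℕ.* p))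
             (trans (ℤ.*-comm (-1ℤ ^ ℕ.suc r) _)
               (cong (_* -1ℤ ^ ℕ.suc r) (trans (cong (-1ℤ ^_) (ℕ.*-comm k p)) (-1^odd* P k))))))
  ... | no r≮P = fromℕ< t<P , (begin
    + q * (-1ℤ ^ a * + a)            ≡⟨ assoc (+ q) (-1ℤ ^ a) (+ a) ⟩
    -1ℤ ^ a * (+ q * + a)            ≈⟨ *-congˡ { -1ℤ ^ a} (multiple+ (+ ℕ.suc k) qa) ⟩
    -1ℤ ^ a * - + ℕ.suc t            ≡⟨ cong (_* - + ℕ.suc t) sgn ⟩
    (-1ℤ * -1ℤ ^ k) * -1ℤ ^ ℕ.suc t * - + ℕ.suc t
      ≡⟨ signs (-1ℤ ^ k) (-1ℤ ^ ℕ.suc t) (+ ℕ.suc t) ⟩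
    -1ℤ ^ k * (-1ℤ ^ ℕ.suc t * + ℕ.suc t)
      ≡⟨ cong (λ t → -1ℤ ^ k * (-1ℤ ^ ℕ.suc t * + ℕ.suc t)) (Fin.toℕ-fromℕ< t<P) ⟨
    -1ℤ ^ k * f (fromℕ< t<P)         ∎)
    where
    open SetoidReasoning setoid
    a t : ℕ
    a = ℕ.suc (toℕ i)
    -- `ℕ.suc t` is p minus the remainder `ℕ.suc r`.
    t = P ℕ.+ P ∸ ℕ.suc r
    r+t : ℕ.suc r ℕ.+ t ≡ P ℕ.+ P
    r+t = ℕ.m+[n∸m]≡n (ℕ.s≤s⁻¹ r<p)
    t<P : t ℕ.< P
    t<P = ℕ.+-cancelˡ-< P t P (ℕ.<-≤-trans (ℕ.s≤s (ℕ.+-monoˡ-≤ t (ℕ.≮⇒≥ r≮P))) (ℕ.≤-reflexive r+t))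
    assoc : ∀ x y z → x * (y * z) ≡ y * (x * z)
    assoc = solve-∀
    signs : ∀ x y z → (-1ℤ * x) * y * - z ≡ x * (y * z)
    signs = solve-∀
    complement : q ℕ.* a ℕ.+ ℕ.suc t ≡ ℕ.suc k ℕ.* p
    complement = trans (cong (ℕ._+ ℕ.suc t) eq) (trans (rearrange r (k ℕ.* p) t)
                   (cong (λ s → ℕ.suc s ℕ.+ k ℕ.* p) r+t))
      where
      rearrange : ∀ r y t → ℕ.suc r ℕ.+ y ℕ.+ ℕ.suc t ≡ ℕ.suc (ℕ.suc r ℕ.+ t) ℕ.+ y
      rearrange = ℕSolver.solve-∀
    qa : + q * + a ≡ - + ℕ.suc t + + ℕ.suc k * + p
    qa = trans (sym (ℤ.pos-* q a)) (trans (move (+ (q ℕ.* a)) (+ ℕ.suc t))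
           (cong (λ y → - + ℕ.suc t + y) (trans (sym (ℤ.pos-+ (q ℕ.* a) (ℕ.suc t)))
             (trans (cong +_ complement) (ℤ.pos-* (ℕ.suc k) p)))))
      where
      move : ∀ x y → x ≡ - y + (x + y)
      move = solve-∀
    -- Reading `complement` modulo 2 gives `total`; multiplying by `s`, whose square is 1, isolates
    -- the power with exponent a.
    sgn : -1ℤ ^ a ≡ (-1ℤ * -1ℤ ^ k) * -1ℤ ^ ℕ.suc t
    sgn = trans (sym (ℤ.*-identityʳ _)) (trans (cong (-1ℤ ^ a *_) (sym (square-sign (ℕ.suc t))))
            (trans (sym (ℤ.*-assoc (-1ℤ ^ a) s s)) (cong (_* s) total)))
      where
      s = -1ℤ ^ ℕ.suc t
      total : -1ℤ ^ a * s ≡ -1ℤ ^ ℕ.suc k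
      total = trans (cong (_* s) (sym (-1^odd* Q a)))
               (trans (sym (ℤ.^-distribˡ-+-* -1ℤ (q ℕ.* a) (ℕ.suc t)))
                 (trans (cong (-1ℤ ^_) (trans complement (ℕ.*-comm (ℕ.suc k) p))) (-1^odd* P (ℕ.suc k))))

  images : ∀ i → ∃[ j ] + q * f i ≈ -1ℤ ^ quot i * f j
  images i = image i {quot i} (rem i) (division i) (rem>0 i) (ℕ.m%n<n (q ℕ.* ℕ.suc (toℕ i)) p)

  α : Fin P → Fin P
  α i = proj₁ (images i)

  -- Squaring removes the signs: q² a² ≈ b², so the image b determines a², and hence a.
  α-injective : Injective _≡_ _≡_ α
  α-injective {i} {j} eq = val²-injective (*-cancelˡ (unit-* q-unit q-unit)
    (≈-trans (square i) (≈-trans (≈-reflexive (cong (λ k → val k * val k) eq)) (≈-sym (square j)))))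
    where
    open SetoidReasoning setoid
    swap : ∀ x y → (x * x) * (y * y) ≡ (x * y) * (x * y)
    swap = solve-∀
    square : ∀ i → (+ q * + q) * (val i * val i) ≈ val (α i) * val (α i)
    square i = begin
      (+ q * + q) * (val i * val i)               ≡⟨ cong ((+ q * + q) *_) (f² i) ⟨
      (+ q * + q) * (f i * f i)                   ≡⟨ swap (+ q) (f i) ⟩
      (+ q * f i) * (+ q * f i)                   ≈⟨ *-cong (proj₂ (images i)) (proj₂ (images i)) ⟩
      (-1ℤ ^ quot i * f (α i)) * (-1ℤ ^ quot i * f (α i)) ≡⟨ signed-square (quot i) (f (α i)) ⟩
      f (α i) * f (α i)                           ≡⟨ f² (α i) ⟩
      val (α i) * val (α i)                       ∎

  -- Each sign left by `gauss` is the product over one column of the rectangle.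
  eisenstein : (+ q) ^ P ≈ rectangle p q P Q
  eisenstein = ≈-trans
    (gauss f (λ i → -1ℤ ^ quot i) f-unit α α-injective (+ q) (λ i → proj₂ (images i)))
    (≈-reflexive (sym (Π.sum-cong-≗ {P} (λ i → column p q (toℕ i) Q (division i) (rem>0 i)
      (ℕ.m%n<n (q ℕ.* ℕ.suc (toℕ i)) p)
      (quotient-bound P Q (quot i) (rem i) (ℕ.suc (toℕ i)) (division i) (Fin.toℕ<n i))))))

  legendre-rectangle : legendre (+ q) p {{p-prime}} ≡ rectangle p q P Q
  legendre-rectangle = let sgn , eq = legendre-euler (+ q) q-unit in
    sign-≈ sgn (isSign-rectangle p q P Q) (≈-trans eq eisenstein)

-- Reciprocity for distinct odd primes.

module Distinct (P′ Q′ : ℕ)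
                (p-prime : Prime (ℕ.suc (ℕ.suc P′ ℕ.+ ℕ.suc P′)))
                (q-prime : Prime (ℕ.suc (ℕ.suc Q′ ℕ.+ ℕ.suc Q′)))
                (p∤q : ¬ + ℕ.suc (ℕ.suc P′ ℕ.+ ℕ.suc P′) Signed.∣ + ℕ.suc (ℕ.suc Q′ ℕ.+ ℕ.suc Q′))
                (q∤p : ¬ + ℕ.suc (ℕ.suc Q′ ℕ.+ ℕ.suc Q′) Signed.∣ + ℕ.suc (ℕ.suc P′ ℕ.+ ℕ.suc P′))
                where
  open OddPrime P′ p-prime
  open OddPrime Q′ q-prime using () renaming (P to Q; p to q; ≈0⇒∣ to ≈0⇒∣′)

  -- On the line p would divide q (i + 1), but it divides neither q nor i + 1 ≤ P.
  offdiagonal : ∀ (i : Fin P) (j : Fin Q) → p ℕ.* ℕ.suc (toℕ j) ≢ q ℕ.* ℕ.suc (toℕ i)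
  offdiagonal i j eq = unit-* (p∤q ∘ ≈0⇒∣) (val-unit half<p i)
    (∣⇒≈0 (Signed.divides (val j) (begin
      + q * val i                   ≡⟨ ℤ.pos-* q (ℕ.suc (toℕ i)) ⟨
      + (q ℕ.* ℕ.suc (toℕ i))       ≡⟨ cong +_ eq ⟨
      + (p ℕ.* ℕ.suc (toℕ j))       ≡⟨ cong +_ (ℕ.*-comm p (ℕ.suc (toℕ j))) ⟩
      + (ℕ.suc (toℕ j) ℕ.* p)       ≡⟨ ℤ.pos-* (ℕ.suc (toℕ j)) p ⟩
      val j * + p                   ∎)))
    where open ≡-Reasoning

  legendre-product :
    legendre (+ p) q {{q-prime}} * legendre (+ q) p {{p-prime}} ≡ -1ℤ ^ (P ℕ.* Q)
  legendre-product = begin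
    legendre (+ p) q {{q-prime}} * legendre (+ q) p {{p-prime}}
      ≡⟨ cong₂ _*_ (Eisenstein.legendre-rectangle Q′ q-prime P (q∤p ∘ ≈0⇒∣′))
                   (Eisenstein.legendre-rectangle P′ p-prime Q (p∤q ∘ ≈0⇒∣)) ⟩
    rectangle q p Q P * rectangle p q P Q
      ≡⟨ ℤ.*-comm (rectangle q p Q P) (rectangle p q P Q) ⟩
    rectangle p q P Q * rectangle q p Q P
      ≡⟨ rectangle-reciprocity p q P Q offdiagonal ⟩
    -1ℤ ^ (P ℕ.* Q) ∎
    where open ≡-Reasoning

half-double : ∀ k → (k ℕ.+ k) / 2 ≡ k
half-double k = trans (cong (_/ 2) (twice k)) (ℕ.m*n/n≡m k 2)
  where
  twice : ∀ k → k ℕ.+ k ≡ k ℕ.* 2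
  twice = ℕSolver.solve-∀

-- The witness is (p - 1) / 2 - 1, the parameter `P′` of `OddPrime`; it exists because p is not 1.
odd-prime-form : ∀ {p} → Prime p → ¬ (2 ∣ p) → ∃[ k ] p ≡ ℕ.suc (ℕ.suc k ℕ.+ ℕ.suc k)
odd-prime-form {p} p-prime odd = go (p % 2) (p / 2) (ℕ.m%n<n p 2) (ℕ.m≡m%n+[m/n]*n p 2)
  where
  twice : ∀ k → ℕ.suc (k ℕ.* 2) ≡ ℕ.suc (k ℕ.+ k)
  twice = ℕSolver.solve-∀
  go : ∀ r k → r ℕ.< 2 → p ≡ r ℕ.+ k ℕ.* 2 → ∃[ k ] p ≡ ℕ.suc (ℕ.suc k ℕ.+ ℕ.suc k)
  go 0 k _ eq = contradiction (ℕ.divides k eq) odd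
  go 1 0 _ eq = contradiction (subst Prime eq p-prime) ¬prime[1]
  go 1 (ℕ.suc k) _ eq = k , trans eq (twice (ℕ.suc k))
  go (ℕ.suc (ℕ.suc _)) _ (ℕ.s≤s (ℕ.s≤s ()))

distinct-∤ : ∀ {p q} → Prime p → Prime q → p ≢ q → ¬ + p Signed.∣ + q
distinct-∤ p-prime q-prime p≢q p∣q with prime⇒irreducible q-prime (Signed.∣⇒∣ᵤ p∣q)
... | inj₁ refl = ¬prime[1] p-prime
... | inj₂ p≡q = p≢q p≡q

reciprocity : ∀ {p q} (p-prime : Prime p) (q-prime : Prime q) → ¬ (2 ∣ p) → ¬ (2 ∣ q) → p ≢ q →
  legendre (+ p) q {{q-prime}} * legendre (+ q) p {{p-prime}} ≡ -1ℤ ^ (((p ∸ 1) / 2) ℕ.* ((q ∸ 1) / 2))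
reciprocity p-prime q-prime p-odd q-odd p≢q
  with odd-prime-form p-prime p-odd | odd-prime-form q-prime q-odd
... | P′ , refl | Q′ , refl = trans
  (Distinct.legendre-product P′ Q′ p-prime q-prime
    (distinct-∤ p-prime q-prime p≢q) (distinct-∤ q-prime p-prime (p≢q ∘ sym)))
  (cong₂ (λ k l → -1ℤ ^ (k ℕ.* l)) (sym (half-double (ℕ.suc P′))) (sym (half-double (ℕ.suc Q′))))

-- Parity of the exponent from the classes of p and q modulo 4.

half-1mod4 : ∀ p → p % 4 ≡ 1 → (p ∸ 1) / 2 ≡ p / 4 ℕ.+ p / 4
half-1mod4 p p%4≡1 = begin
  (p ∸ 1) / 2                          ≡⟨ cong (λ x → (x ∸ 1) / 2) (ℕ.m≡m%n+[m/n]*n p 4) ⟩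
  (p % 4 ℕ.+ p / 4 ℕ.* 4 ∸ 1) / 2      ≡⟨ cong (λ r → (r ℕ.+ p / 4 ℕ.* 4 ∸ 1) / 2) p%4≡1 ⟩
  (p / 4 ℕ.* 4) / 2                    ≡⟨ cong (_/ 2) (split (p / 4)) ⟩
  (p / 4 ℕ.+ p / 4) ℕ.* 2 / 2          ≡⟨ ℕ.m*n/n≡m (p / 4 ℕ.+ p / 4) 2 ⟩
  p / 4 ℕ.+ p / 4                      ∎
  where
  open ≡-Reasoning
  split : ∀ t → t ℕ.* 4 ≡ (t ℕ.+ t) ℕ.* 2
  split = ℕSolver.solve-∀

half-3mod4 : ∀ p → p % 4 ≡ 3 → (p ∸ 1) / 2 ≡ ℕ.suc (p / 4 ℕ.+ p / 4)
half-3mod4 p p%4≡3 = begin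
  (p ∸ 1) / 2                          ≡⟨ cong (λ x → (x ∸ 1) / 2) (ℕ.m≡m%n+[m/n]*n p 4) ⟩
  (p % 4 ℕ.+ p / 4 ℕ.* 4 ∸ 1) / 2      ≡⟨ cong (λ r → (r ℕ.+ p / 4 ℕ.* 4 ∸ 1) / 2) p%4≡3 ⟩
  (2 ℕ.+ p / 4 ℕ.* 4) / 2              ≡⟨ cong (_/ 2) (split (p / 4)) ⟩
  ℕ.suc (p / 4 ℕ.+ p / 4) ℕ.* 2 / 2    ≡⟨ ℕ.m*n/n≡m (ℕ.suc (p / 4 ℕ.+ p / 4)) 2 ⟩
  ℕ.suc (p / 4 ℕ.+ p / 4)              ∎
  where
  open ≡-Reasoning
  split : ∀ t → 2 ℕ.+ t ℕ.* 4 ≡ ℕ.suc (t ℕ.+ t) ℕ.* 2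
  split = ℕSolver.solve-∀

-1^even* : ∀ n m → -1ℤ ^ ((n ℕ.+ n) ℕ.* m) ≡ 1ℤ
-1^even* n m = trans (sym (ℤ.^-*-assoc -1ℤ (n ℕ.+ n) m))
  (trans (cong (_^ m) (-1^even n)) (ℤ.^-zeroˡ m))

signs-equal : ∀ {s t} → IsSign s → IsSign t → s * t ≡ 1ℤ → s ≡ t
signs-equal (inj₁ refl) (inj₁ refl) _ = refl
signs-equal (inj₁ refl) (inj₂ refl) ()
signs-equal (inj₂ refl) (inj₁ refl) ()
signs-equal (inj₂ refl) (inj₂ refl) _ = refl

signs-opposite : ∀ {s t} → IsSign s → IsSign t → s * t ≡ -1ℤ → s ≡ - t
signs-opposite (inj₁ refl) (inj₂ refl) _ = refl
signs-opposite (inj₂ refl) (inj₁ refl) _ = refl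
signs-opposite (inj₁ refl) (inj₁ refl) ()
signs-opposite (inj₂ refl) (inj₂ refl) ()

theorem0p6 : ∀ (p q : ℕ) {{_ : Prime p}} {{_ : Prime q}} → ¬ (2 ∣ p) → ¬ (2 ∣ q) →
    (p ≢ q → legendre (+ p) q * legendre (+ q) p ≡ -1ℤ ^ (((p ∸ 1) / 2) ℕ.* ((q ∸ 1) / 2)))
    × (p % 4 ≡ 1 ⊎ q % 4 ≡ 1 → legendre (+ p) q ≡ legendre (+ q) p)
    × (p % 4 ≡ 3 × q % 4 ≡ 3 → legendre (+ p) q ≡ - legendre (+ q) p)
theorem0p6 p q {{p-prime}} {{q-prime}} p-odd q-odd = product , equal , opposite
  where
  product : p ≢ q →
    legendre (+ p) q * legendre (+ q) p ≡ -1ℤ ^ (((p ∸ 1) / 2) ℕ.* ((q ∸ 1) / 2))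
  product = reciprocity p-prime q-prime p-odd q-odd
  p/q-sign : p ≢ q → IsSign (legendre (+ p) q)
  p/q-sign p≢q = legendre-sign (+ p) q q-prime (distinct-∤ q-prime p-prime (p≢q ∘ sym))
  q/p-sign : p ≢ q → IsSign (legendre (+ q) p)
  q/p-sign p≢q = legendre-sign (+ q) p p-prime (distinct-∤ p-prime q-prime p≢q)
  even-exponent : p % 4 ≡ 1 ⊎ q % 4 ≡ 1 → -1ℤ ^ (((p ∸ 1) / 2) ℕ.* ((q ∸ 1) / 2)) ≡ 1ℤ
  even-exponent (inj₁ p%4≡1) = trans
    (cong (λ k → -1ℤ ^ (k ℕ.* ((q ∸ 1) / 2))) (half-1mod4 p p%4≡1))
    (-1^even* (p / 4) ((q ∸ 1) / 2))
  even-exponent (inj₂ q%4≡1) = trans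
    (cong (-1ℤ ^_) (trans (ℕ.*-comm ((p ∸ 1) / 2) ((q ∸ 1) / 2))
      (cong (ℕ._* ((p ∸ 1) / 2)) (half-1mod4 q q%4≡1))))
    (-1^even* (q / 4) ((p ∸ 1) / 2))
  equal : p % 4 ≡ 1 ⊎ q % 4 ≡ 1 → legendre (+ p) q ≡ legendre (+ q) p
  equal mod4 with p ℕ.≟ q
  ... | yes refl = refl
  ... | no p≢q =
    signs-equal (p/q-sign p≢q) (q/p-sign p≢q) (trans (product p≢q) (even-exponent mod4))
  opposite : p % 4 ≡ 3 × q % 4 ≡ 3 → legendre (+ p) q ≡ - legendre (+ q) p
  opposite (p%4≡3 , q%4≡3) with p ℕ.≟ q
  -- For p = q both symbols are 0, and 0 is its own negative.
  ... | yes refl = trans p/p≡0 (cong -_ (sym p/p≡0))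
    where
    p/p≡0 : legendre (+ p) p {{p-prime}} ≡ 0ℤ
    p/p≡0 = legendre-multiple (+ p) p p-prime Signed.∣-refl
  ... | no p≢q = signs-opposite (p/q-sign p≢q) (q/p-sign p≢q) (begin
    legendre (+ p) q * legendre (+ q) p
      ≡⟨ product p≢q ⟩
    -1ℤ ^ (((p ∸ 1) / 2) ℕ.* ((q ∸ 1) / 2))
      -- Both halves are odd, so their product is odd.
      ≡⟨ cong₂ (λ k l → -1ℤ ^ (k ℕ.* l)) (half-3mod4 p p%4≡3) (half-3mod4 q q%4≡3) ⟩
    -1ℤ ^ (ℕ.suc (p / 4 ℕ.+ p / 4) ℕ.* ℕ.suc (q / 4 ℕ.+ q / 4))
      ≡⟨ -1^odd* (p / 4) (ℕ.suc (q / 4 ℕ.+ q / 4)) ⟩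
    -1ℤ ^ ℕ.suc (q / 4 ℕ.+ q / 4)
      ≡⟨ -1^odd (q / 4) ⟩
    -1ℤ ∎)
    where open ≡-Reasoning
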